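{- Let $H$ be a graph with at least one edge and chromatic number $\chi(H)\neq 3$. Then $$\mathrm{ex}_r(n, H)=\left(1-\frac{1}{\chi(H)-1}+o(1)\right) n \quad\text{as } n\to\infty.$$
   Context: For a graph $H$ and a positive integer $n$, the regular Turán number $\mathrm{ex}_r(n,H)$ is the maximum integer $k$ such that there exists a $k$-regular graph on $n$ vertices that does not contain $H$ as a subgraph. Graphs are finite and simple. -}

module Defs where

open import Data.Nat using (ℕ; zero; suc; _+_; _*_; _∸_; _≤_; ∣_-_∣)
open import Data.Fin using (Fin)
open import Data.Bool using (Bool; true; false; if_then_else_)
open import Data.List using (List; map; allFin)
open import Data.Nat.ListAction using (sum)
open import Data.Empty using (⊥)
open import Data.Product using (Σ; ∃; _×_; _,_)
open import Relation.Binary.PropositionalEquality using (_≡_; _≢_)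
open import Function.Definitions using (Injective)

record Graph (n : ℕ) : Set where
  field
    adj   : Fin n → Fin n → Bool
    sym   : ∀ u v → adj u v ≡ adj v u
    loopless : ∀ u → adj u u ≡ false
open Graph public

degree : ∀ {n} → Graph n → Fin n → ℕ
degree {n} G u = sum (map (λ v → if adj G u v then 1 else 0) (allFin n))

Regular : ∀ {n} → Graph n → ℕ → Set
Regular G k = ∀ u → degree G u ≡ k

HasEdge : ∀ {m} → Graph m → Set
HasEdge H = Σ _ λ u → Σ _ λ v → adj H u v ≡ true

Contains : ∀ {n m} → Graph n → Graph m → Set
Contains {n} {m} G H =
  Σ (Fin m → Fin n) λ f → Injective _≡_ _≡_ f ×
    (∀ u v → adj H u v ≡ true → adj G (f u) (f v) ≡ true)

Colorable : ∀ {m} → Graph m → ℕ → Set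
Colorable {m} H c =
  Σ (Fin m → Fin c) λ col → ∀ u v → adj H u v ≡ true → col u ≢ col v

IsChromaticNumber : ∀ {m} → Graph m → ℕ → Set
IsChromaticNumber H c = Colorable H c × (∀ k → Colorable H k → c ≤ k)

IsRegTuran : ∀ {m} → ℕ → Graph m → ℕ → Set
IsRegTuran n H k =
  (Σ (Graph n) λ G → Regular G k × (Contains G H → ⊥)) ×
  (∀ k' → (Σ (Graph n) λ G → Regular G k' × (Contains G H → ⊥)) → k' ≤ k)

{-# OPTIONS --safe #-}
-- Put r = χ(H) − 1. Upper bound (Erdős–Stone for minimum degree): let a graph of
-- minimum degree at least (1 − 1/r + ε)n contain the complete r-partite graph
-- K_r(T). Counting edges at this copy, linearly many vertices have t neighbours
-- in each class, and by pigeonhole t of them share the same t neighbours in each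
-- class; this is a K_{r+1}(t), and K_{r+1}(|H|) contains H.
--
-- Lower bound, r ≥ 3: write n = 2hr + s with s < 2r and take the complete r-partite
-- graph with one part of size 2h + s and r − 1 parts of size 2h. Vertices of the
-- small parts have degree too large by s. Split every small part into two halves,
-- pair the first half of each small part with the second half of the cyclically
-- next one, and delete an s-regular bipartite graph inside every pair. This needs
-- at least two small parts, which is where r = 2 fails. The result is regular of
-- degree (r − 1)2h and r-colourable, hence H-free.
module Submission where

open import Defs hiding (sym)
import Algebra.Properties.Semiring.Sum
open import Data.Bool using (Bool; true; false; if_then_else_; not; _∧_)
open import Data.Fin using (Fin; zero; suc; toℕ; _↑ˡ_; _↑ʳ_; combine; splitAt; remQuot; funToFin; finToFun; punchIn; inject₁; fromℕ; inject≤)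
open import Data.Fin.Properties using (all?; ¬∀⟶∃¬; suc-injective; finToFun-funToFin; splitAt-↑ˡ; splitAt-↑ʳ; remQuot-combine; toℕ-inject₁; toℕ-fromℕ; toℕ<n; inject≤-injective) renaming (_≟_ to _≟ᶠ_)
import Data.List as List using (tabulate)
import Data.List.Properties as List using (map-tabulate)
import Data.Nat.ListAction as List using (sum)
open import Data.Nat using (ℕ; zero; suc; _+_; _*_; _^_; _∸_; _≤_; _<_; _<ᵇ_; _≡ᵇ_; z≤n; s≤s; ∣_-_∣)
open import Data.Nat.DivMod using (_/_; _%_; [m+n]%n≡m%n; n%n≡0; m<n⇒m%n≡m; m%n<n; m≡m%n+[m/n]*n)
open import Data.Nat.Properties as Nat hiding (suc-injective)
open import Data.Nat.Tactic.RingSolver using (solve-∀)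
open import Data.Product as Product using (Σ; ∃; _×_; _,_; proj₁; proj₂)
open import Data.Sum as Sum using (_⊎_; inj₁; inj₂)
open import Data.Vec.Functional using (removeAt)
open import Function using (_∘_)
open import Function.Definitions using (Injective)
open import Relation.Binary.PropositionalEquality using (_≡_; _≢_; refl; sym; trans; cong; cong₂; subst; module ≡-Reasoning)
open import Relation.Nullary using (Dec; yes; no; does; contradiction)
open import Relation.Nullary.Decidable using (dec-true)

open Algebra.Properties.Semiring.Sum +-*-semiring

-- Finite sums, counting and pigeonhole

bit : Bool → ℕ
bit b = if b then 1 else 0

sum-mono-≤ : ∀ {n} {f g : Fin n → ℕ} → (∀ i → f i ≤ g i) → sum f ≤ sum g
sum-mono-≤ {zero}  f≤g = z≤n
sum-mono-≤ {suc n} f≤g = +-mono-≤ (f≤g zero) (sum-mono-≤ (f≤g ∘ suc))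

sum-const : ∀ n x → ∑[ i < n ] x ≡ n * x
sum-const zero    x = refl
sum-const (suc n) x = cong (x +_) (sum-const n x)

sum-≤ : ∀ {n} {f : Fin n → ℕ} x → (∀ i → f i ≤ x) → sum f ≤ n * x
sum-≤ {n} x f≤x = ≤-trans (sum-mono-≤ f≤x) (≤-reflexive (sum-const n x))

sum-bit-≟ : ∀ {n} (i : Fin n) → ∑[ j < n ] bit (does (i ≟ᶠ j)) ≡ 1
sum-bit-≟ {suc n} zero = cong suc (sum-replicate-zero n)
sum-bit-≟ (suc i) = sum-bit-≟ i

≟-sym : ∀ {n} (i j : Fin n) → does (i ≟ᶠ j) ≡ does (j ≟ᶠ i)
≟-sym zero    zero    = refl
≟-sym zero    (suc j) = refl
≟-sym (suc i) zero    = refl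
≟-sym (suc i) (suc j) = ≟-sym i j

degree-sum : ∀ {n} (G : Graph n) u → degree G u ≡ ∑[ v < n ] bit (adj G u v)
degree-sum {n} G u =
  trans (cong List.sum (List.map-tabulate (λ v → v) (bit ∘ adj G u))) (go (bit ∘ adj G u))
  where
  go : ∀ {m} (f : Fin m → ℕ) → List.sum (List.tabulate f) ≡ sum f
  go {zero}  f = refl
  go {suc m} f = cong (f zero +_) (go (f ∘ suc))

choose : ∀ {n} (P : Fin n → Bool) {t} → t ≤ sum (bit ∘ P) →
  Σ (Fin t → Fin n) λ e → Injective _≡_ _≡_ e × (∀ i → P (e i) ≡ true)
choose P {zero} _ = (λ ()) , (λ {}) , λ ()
choose {suc n} P {suc t} t≤ with P zero in P0
... | false with e , inj , Pe ← choose (P ∘ suc) t≤ = suc ∘ e , inj ∘ suc-injective , Pe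
... | true with e , inj , Pe ← choose (P ∘ suc) (≤-pred t≤) = e′ , inj′ , Pe′
  where
  e′ : Fin (suc t) → Fin (suc n)
  e′ zero    = zero
  e′ (suc i) = suc (e i)
  inj′ : Injective _≡_ _≡_ e′
  inj′ {zero}  {zero}  _  = refl
  inj′ {suc i} {suc j} eq = cong suc (inj (suc-injective eq))
  Pe′ : ∀ i → P (e′ i) ≡ true
  Pe′ zero    = P0
  Pe′ (suc i) = Pe i

does-true : ∀ {p} {P : Set p} (P? : Dec P) → does P? ≡ true → P
does-true (yes p) _ = p

bit-≤1 : ∀ b → bit b ≤ 1
bit-≤1 true  = s≤s z≤n
bit-≤1 false = z≤n

-- The fibre sizes sum to `x`; if every fibre had at most `t` elements, then `x ≤ M * t`.
pigeonhole-fibre : ∀ {x M} t (c : Fin x → Fin M) → M * t < x →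
  Σ (Fin M) λ o → Σ (Fin t → Fin x) λ g → Injective _≡_ _≡_ g × (∀ i → c (g i) ≡ o)
pigeonhole-fibre {x} {M} t c Mt<x
  with all? (λ o → ∑[ j < x ] bit (does (c j ≟ᶠ o)) ≤? t)
... | yes small = contradiction Mt<x (≤⇒≯ (begin
  x                                            ≡⟨ *-identityʳ x ⟨
  x * 1                                        ≡⟨ sum-const x 1 ⟨
  ∑[ j < x ] 1                                 ≡⟨ sum-cong-≗ (λ j → sum-bit-≟ (c j)) ⟨
  ∑[ j < x ] ∑[ o < M ] bit (does (c j ≟ᶠ o))  ≡⟨ ∑-comm (λ j o → bit (does (c j ≟ᶠ o))) ⟩
  ∑[ o < M ] ∑[ j < x ] bit (does (c j ≟ᶠ o))  ≤⟨ sum-≤ t small ⟩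
  M * t                                        ∎))
  where open ≤-Reasoning
... | no ¬small
  with o , big ← ¬∀⟶∃¬ M _ (λ o → ∑[ j < x ] bit (does (c j ≟ᶠ o)) ≤? t) ¬small
  with g , inj , eq ← choose (λ j → does (c j ≟ᶠ o)) (<⇒≤ (≰⇒> big))
  = o , g , inj , λ i → does-true (c (g i) ≟ᶠ o) (eq i)

-- Complete multipartite subgraphs and Erdős-Stone for minimum degree

-- Vertices of different classes are distinct because they are adjacent.
Multipartite : ∀ {n} → Graph n → ℕ → ℕ → Set
Multipartite {n} G r t = Σ (Fin r → Fin t → Fin n) λ f →
  (∀ a → Injective _≡_ _≡_ (f a)) × (∀ a b i j → a ≢ b → adj G (f a i) (f b j) ≡ true)

-- The colour of a vertex selects the class and the vertex itself is the index inside it, so classes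
-- of size `m` suffice. Two colours cannot share an image, since that would create a loop.
multipartite⇒contains : ∀ {n m r} (G : Graph n) (H : Graph m) →
  Colorable H r → Multipartite G r m → Contains G H
multipartite⇒contains G H (col , proper) (f , inj , joined) =
  (λ u → f (col u) u) , h-inj , λ u v uv → joined (col u) (col v) u v (proper u v uv)
  where
  h-inj : Injective _≡_ _≡_ (λ u → f (col u) u)
  h-inj {u} {v} eq with col u ≟ᶠ col v
  ... | yes same = inj (col v) (trans (cong (λ a → f a u) (sym same)) eq)
  ... | no  diff with () ← trans (sym (loopless G _))
                       (subst (λ w → adj G (f (col u) u) w ≡ true) (sym eq) (joined _ _ u v diff))

module Extend {n} (G : Graph n) {r T} (K : Multipartite G (suc r) T) (t : ℕ) where
  f = proj₁ K

  nbrs : Fin (suc r) → Fin n → ℕ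
  nbrs a v = ∑[ i < T ] bit (adj G (f a i) v)

  Good? : ∀ v → Dec (∀ a → t ≤ nbrs a v)
  Good? v = all? (λ a → t ≤? nbrs a v)

  good : Fin n → Bool
  good v = does (Good? v)

  goods : ℕ
  goods = sum (bit ∘ good)

  nbrs-≤ : ∀ a v → nbrs a v ≤ T
  nbrs-≤ a v = ≤-trans (sum-≤ 1 (λ i → bit-≤1 (adj G (f a i) v))) (≤-reflexive (*-identityʳ T))

  -- A good vertex gets the trivial bound. Any other one has fewer than `t` neighbours in some class
  -- and at most `T` in each of the remaining `r`.
  ∑-nbrs-≤ : ∀ v → ∑[ a < suc r ] nbrs a v ≤ bit (good v) * (suc r * T) + (r * T + t)
  ∑-nbrs-≤ v = split (Good? v)
    where
    open ≤-Reasoning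
    split : (g? : Dec (∀ a → t ≤ nbrs a v)) →
      ∑[ a < suc r ] nbrs a v ≤ bit (does g?) * (suc r * T) + (r * T + t)
    split (yes _) = begin
      ∑[ a < suc r ] nbrs a v        ≤⟨ sum-≤ T (λ a → nbrs-≤ a v) ⟩
      suc r * T                      ≡⟨ +-identityʳ (suc r * T) ⟨
      1 * (suc r * T)                ≤⟨ m≤m+n _ (r * T + t) ⟩
      1 * (suc r * T) + (r * T + t)  ∎
    split (no ¬g) with a , few ← ¬∀⟶∃¬ (suc r) _ (λ a → t ≤? nbrs a v) ¬g = begin
      ∑[ b < suc r ] nbrs b v                       ≡⟨ sum-remove {i = a} (λ b → nbrs b v) ⟩
      nbrs a v + sum (removeAt (λ b → nbrs b v) a)  ≤⟨ +-mono-≤ (<⇒≤ (≰⇒> few)) (sum-≤ T (λ b → nbrs-≤ (punchIn a b) v)) ⟩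
      t + r * T                                     ≡⟨ +-comm t (r * T) ⟩
      r * T + t                                     ∎

  -- Counts the pairs of a vertex of the copy and a neighbour of it, first from the copy and then
  -- from the neighbours.
  double-count : ∀ {d} → (∀ u → d ≤ degree G u) →
    suc r * (T * d) ≤ goods * (suc r * T) + n * (r * T + t)
  double-count {d} d≤ = begin
    suc r * (T * d)
      ≡⟨ sum-const (suc r) (T * d) ⟨
    ∑[ a < suc r ] (T * d)
      ≡⟨ sum-cong-≗ {suc r} (λ _ → sum-const T d) ⟨
    ∑[ a < suc r ] ∑[ i < T ] d
      ≤⟨ sum-mono-≤ (λ a → sum-mono-≤ (λ i → ≤-trans (d≤ (f a i)) (≤-reflexive (degree-sum G (f a i))))) ⟩
    ∑[ a < suc r ] ∑[ i < T ] ∑[ v < n ] bit (adj G (f a i) v)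
      ≡⟨ sum-cong-≗ (λ a → ∑-comm (λ i v → bit (adj G (f a i) v))) ⟩
    ∑[ a < suc r ] ∑[ v < n ] nbrs a v
      ≡⟨ ∑-comm nbrs ⟩
    ∑[ v < n ] ∑[ a < suc r ] nbrs a v
      ≤⟨ sum-mono-≤ ∑-nbrs-≤ ⟩
    ∑[ v < n ] (bit (good v) * (suc r * T) + (r * T + t))
      ≡⟨ ∑-distrib-+ (λ v → bit (good v) * (suc r * T)) (λ _ → r * T + t) ⟩
    ∑[ v < n ] (bit (good v) * (suc r * T)) + ∑[ v < n ] (r * T + t)
      ≡⟨ cong₂ _+_ (*-distribʳ-sum (suc r * T) (bit ∘ good)) (sym (sum-const n (r * T + t))) ⟨
    goods * (suc r * T) + n * (r * T + t)
      ∎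
    where open ≤-Reasoning

  -- Each good vertex picks `t` neighbours in every class, with at most `(T ^ t) ^ suc r` outcomes.
  -- So `t` good vertices make the same picks, and these vertices form the new class.
  extend : ((T ^ t) ^ suc r) * t < goods → Multipartite G (suc (suc r)) t
  extend many
    with e , e-inj , e-good ← choose good ≤-refl = result
    where
    select : ∀ j a → Σ (Fin t → Fin T) λ s →
      Injective _≡_ _≡_ s × (∀ i → adj G (f a (s i)) (e j) ≡ true)
    select j a = choose (λ i → adj G (f a i) (e j)) (does-true (Good? (e j)) (e-good j) a)

    -- The whole family of picks becomes one element of a finite set, ready for the pigeonhole
    -- principle.
    code : Fin goods → Fin ((T ^ t) ^ suc r)
    code j = funToFin (λ a → funToFin (proj₁ (select j a)))

    result : Multipartite G (suc (suc r)) t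
    result with o , g , g-inj , g-code ← pigeonhole-fibre t code many = f′ , f′-inj , f′-joined
      where
      S : Fin (suc r) → Fin t → Fin T
      S a = finToFun (finToFun o a)

      S-select : ∀ l a i → S a i ≡ proj₁ (select (g l) a) i
      S-select l a i = trans
        (cong (λ x → finToFun x i)
          (trans (cong (λ x → finToFun x a) (sym (g-code l)))
            (finToFun-funToFin (λ b → funToFin (proj₁ (select (g l) b))) a)))
        (finToFun-funToFin (proj₁ (select (g l) a)) i)

      f′ : Fin (suc (suc r)) → Fin t → Fin n
      f′ zero    i = e (g i)
      f′ (suc a) i = f a (S a i)

      f′-inj : ∀ a → Injective _≡_ _≡_ (f′ a)
      f′-inj zero    eq = g-inj (e-inj eq)
      -- `S a` agrees with the picks of every `g l`. Taking `l = i` supplies such a vertex without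
      -- assuming `t` positive.
      f′-inj (suc a) {i} {j} eq = proj₁ (proj₂ (select (g i) a))
        (trans (sym (S-select i a i)) (trans (proj₁ (proj₂ K) a eq) (S-select i a j)))

      old-new : ∀ a i j → adj G (f a (S a i)) (e (g j)) ≡ true
      old-new a i j = trans (cong (λ x → adj G (f a x) (e (g j))) (S-select j a i))
        (proj₂ (proj₂ (select (g j) a)) i)

      f′-joined : ∀ a b i j → a ≢ b → adj G (f′ a i) (f′ b j) ≡ true
      f′-joined zero    zero    i j ne = contradiction refl ne
      f′-joined zero    (suc b) i j ne = trans (Graph.sym G _ _) (old-new b j i)
      f′-joined (suc a) zero    i j ne = old-new a i j
      f′-joined (suc a) (suc b) i j ne = proj₂ (proj₂ K) a b _ _ (ne ∘ cong suc)

-- The density excess `1/(k+1)` contributes `2 * suc r * suc t * n` to the double count, by the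
-- choice of `T`. The error term `n * t` uses up at most half of it, and the other half must come
-- from the good vertices.
goods-bound : ∀ n d k r t x → let T = 2 * (suc t * suc k) in
  suc r * (T * d) ≤ x * (suc r * T) + n * (r * T + t) →
  r * n * suc k + n * suc r ≤ d * suc r * suc k →
  n ≤ 2 * (suc k * x)
goods-bound n d k r t x counted dense =
  *-cancelˡ-≤ c (+-cancelʳ-≤ (c * n) _ _ (+-cancelˡ-≤ (T * (r * n * suc k)) _ _ (begin
    T * (r * n * suc k) + (c * n + c * n)
      ≡⟨ e₁ n (suc k) r (suc t) ⟩
    T * (r * n * suc k + n * suc r)
      ≤⟨ *-monoʳ-≤ T dense ⟩
    T * (d * suc r * suc k)
      ≡⟨ e₂ T d (suc r) (suc k) ⟩
    suc k * (suc r * (T * d))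
      ≤⟨ *-monoʳ-≤ (suc k) counted ⟩
    suc k * (x * (suc r * T) + n * (r * T + t))
      ≡⟨ e₃ n (suc k) r (suc t) x t ⟩
    T * (r * n * suc k) + (c * (2 * (suc k * x)) + suc k * t * n * 1)
      -- Rounding `t` up to `suc t` and `1` up to `suc r` turns the error term into exactly `c * n`,
      -- which cancels.
      ≤⟨ +-monoʳ-≤ (T * (r * n * suc k)) (+-monoʳ-≤ (c * (2 * (suc k * x)))
           (*-mono-≤ (*-monoˡ-≤ n (*-monoʳ-≤ (suc k) (n≤1+n t))) (s≤s (z≤n {r})))) ⟩
    T * (r * n * suc k) + (c * (2 * (suc k * x)) + suc k * suc t * n * suc r)
      ≡⟨ cong (λ y → T * (r * n * suc k) + (c * (2 * (suc k * x)) + y)) (e₄ n (suc k) (suc r) (suc t)) ⟩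
    T * (r * n * suc k) + (c * (2 * (suc k * x)) + c * n)
      ∎)))
  where
  open ≤-Reasoning
  T = 2 * (suc t * suc k)
  c = suc r * (suc t * suc k)
  e₁ : ∀ n k r t → 2 * (t * k) * (r * n * k) + ((1 + r) * (t * k) * n + (1 + r) * (t * k) * n)
    ≡ 2 * (t * k) * (r * n * k + n * (1 + r))
  e₁ = solve-∀
  e₂ : ∀ T d r k → T * (d * r * k) ≡ k * (r * (T * d))
  e₂ = solve-∀
  e₃ : ∀ n k r t′ x t → k * (x * ((1 + r) * (2 * (t′ * k))) + n * (r * (2 * (t′ * k)) + t))
    ≡ 2 * (t′ * k) * (r * n * k) + ((1 + r) * (t′ * k) * (2 * (k * x)) + k * t * n * 1)
  e₃ = solve-∀
  e₄ : ∀ n k r t → k * t * n * r ≡ r * (t * k) * n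
  e₄ = solve-∀

-- The threshold `1 - 1/r` increases with `r`, so density for one more class passes down the
-- induction. The slack `n * k` comes from `(r+1)^2 = r(r+2) + 1`.
dense-pred : ∀ n d k r → r * n * k + n * suc r ≤ d * suc r * k → (r ∸ 1) * n * k + n * r ≤ d * r * k
dense-pred n d k zero    _     = ≤-trans (≤-reflexive (*-zeroʳ n)) z≤n
dense-pred n d k (suc r) dense = *-cancelˡ-≤ (suc (suc r)) (begin
  suc (suc r) * (r * n * k + n * suc r)          ≤⟨ m≤m+n _ (n * k) ⟩
  suc (suc r) * (r * n * k + n * suc r) + n * k  ≡⟨ e₁ n k r ⟩
  suc r * (suc r * n * k + n * suc (suc r))      ≤⟨ *-monoʳ-≤ (suc r) dense ⟩
  suc r * (d * suc (suc r) * k)                  ≡⟨ e₂ d k (suc r) ⟩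
  suc (suc r) * (d * suc r * k)                  ∎)
  where
  open ≤-Reasoning
  e₁ : ∀ n k r → (2 + r) * (r * n * k + n * (1 + r)) + n * k ≡ (1 + r) * ((1 + r) * n * k + n * (2 + r))
  e₁ = solve-∀
  e₂ : ∀ d k r → r * (d * (1 + r) * k) ≡ (1 + r) * (d * r * k)
  e₂ = solve-∀

-- Induction on `r` with `1/(k+1)` as the density excess: first find a copy with much larger classes
-- of size `T`, then add one class by `extend`. For `r = 0` any `t` vertices form the single class.
erdős-stone : ∀ k r t → ∃ λ N → ∀ n → N ≤ n → (G : Graph n) → ∀ d → (∀ u → d ≤ degree G u) →
  (r ∸ 1) * n * suc k + n * r ≤ d * r * suc k → Multipartite G (suc r) t
erdős-stone k zero t = t , λ n t≤n G d _ _ →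
  (λ _ i → inject≤ i t≤n) , (λ _ → inject≤-injective t≤n t≤n _ _) ,
  λ { zero zero _ _ ne → contradiction refl ne }
-- `N₀` guarantees the copy with classes of size `T`. The other summand forces more than `M * t`
-- good vertices, as there are at least `n / (2 * suc k)` of them.
erdős-stone k (suc r) t = N₀ + suc (2 * (suc k * (M * t))) , λ n N≤n G d d≤ dense →
  let K = proj₂ (erdős-stone k r T) n (m+n≤o⇒m≤o N₀ N≤n) G d d≤ (dense-pred n d (suc k) r dense)
      open Extend G K t
  in extend (≰⇒> λ few → <⇒≱ (m+n≤o⇒n≤o N₀ N≤n)
       (≤-trans (goods-bound n d k r t goods (double-count d≤) dense)
         (*-monoʳ-≤ 2 (*-monoʳ-≤ (suc k) few))))
  where
  T = 2 * (suc t * suc k)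
  M = (T ^ t) ^ suc r
  N₀ = proj₁ (erdős-stone k r T)

-- Sums over concatenated, product and cyclic index sets

sum-↑ : ∀ a {b} (f : Fin (a + b) → ℕ) → sum f ≡ ∑[ i < a ] f (i ↑ˡ b) + ∑[ j < b ] f (a ↑ʳ j)
sum-↑ zero    f = refl
sum-↑ (suc a) f = trans (cong (f zero +_) (sum-↑ a (f ∘ suc))) (sym (+-assoc (f zero) _ _))

sum-combine : ∀ a {b} (f : Fin (a * b) → ℕ) → sum f ≡ ∑[ i < a ] ∑[ j < b ] f (combine i j)
sum-combine zero        f = refl
sum-combine (suc a) {b} f = trans (sum-↑ b f) 
  (cong (∑[ j < b ] f (j ↑ˡ (a * b)) +_) (sum-combine a (f ∘ (b ↑ʳ_))))

-- Moving the window by one drops `F i` and adds `F (i + suc h)`, which are equal by periodicity.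
sum-window : ∀ h (F : ℕ → ℕ) → (∀ x → F (x + suc h) ≡ F x) →
  ∀ i → ∑[ j < suc h ] F (i + toℕ j) ≡ ∑[ j < suc h ] F (toℕ j)
sum-window h F periodic zero    = refl
sum-window h F periodic (suc i) = begin
  ∑[ j < suc h ] F (suc i + toℕ j)
    ≡⟨ sum-init-last (λ j → F (suc i + toℕ j)) ⟩
  ∑[ j < h ] F (suc i + toℕ (inject₁ j)) + F (suc i + toℕ (fromℕ h))
    ≡⟨ cong₂ _+_ (sum-cong-≗ {h} (λ j → cong F (trans (cong (suc i +_) (toℕ-inject₁ j)) (sym (+-suc i _)))))
         (trans (cong F (trans (cong (suc i +_) (toℕ-fromℕ h)) (sym (+-suc i h)))) (periodic i)) ⟩
  ∑[ j < h ] F (i + suc (toℕ j)) + F i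
    ≡⟨ +-comm _ (F i) ⟩
  F i + ∑[ j < h ] F (i + suc (toℕ j))
    ≡⟨ cong (λ x → F x + ∑[ j < h ] F (i + suc (toℕ j))) (+-identityʳ i) ⟨
  ∑[ j < suc h ] F (i + toℕ j)
    ≡⟨ sum-window h F periodic i ⟩
  ∑[ j < suc h ] F (toℕ j)
    ∎
  where open ≡-Reasoning

sum-residues : ∀ h (g : ℕ → ℕ) i → ∑[ j < suc h ] g ((i + toℕ j) % suc h) ≡ ∑[ j < suc h ] g (toℕ j)
sum-residues h g i = trans
  (sum-window h (λ x → g (x % suc h)) (λ x → cong g ([m+n]%n≡m%n x (suc h))) i)
  (sum-cong-≗ {suc h} (λ j → cong g (m<n⇒m%n≡m (toℕ<n j))))

sum-bit-< : ∀ {h s} → s ≤ h → ∑[ j < h ] bit (toℕ j <ᵇ s) ≡ s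
sum-bit-< {h} {zero} _   = sum-replicate-zero h
sum-bit-< (s≤s s≤h)      = cong suc (sum-bit-< s≤h)

sum-bit-≡ᵇˡ : ∀ {q y} → y < q → ∑[ p < q ] bit (toℕ p ≡ᵇ y) ≡ 1
sum-bit-≡ᵇˡ {suc q} {zero}  _         = cong suc (sum-replicate-zero q)
sum-bit-≡ᵇˡ {suc q} {suc y} (s≤s y<q) = sum-bit-≡ᵇˡ {q} {y} y<q

sum-bit-≡ᵇʳ : ∀ {q y} → y < q → ∑[ p < q ] bit (y ≡ᵇ toℕ p) ≡ 1
sum-bit-≡ᵇʳ {suc q} {zero}  _         = cong suc (sum-replicate-zero q)
sum-bit-≡ᵇʳ {suc q} {suc y} (s≤s y<q) = sum-bit-≡ᵇʳ {q} {y} y<q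

bit-∧ : ∀ a b → bit (a ∧ b) ≡ bit a * bit b
bit-∧ true  b = sym (+-identityʳ (bit b))
bit-∧ false b = refl

-- Coordinates for the vertices of the construction

Halves : ℕ → ℕ → Set
Halves q h = Fin q × (Fin h ⊎ Fin h)

sumHalves : ∀ q h → (Halves q h → ℕ) → ℕ
sumHalves q h F = ∑[ p < q ] (∑[ i < h ] F (p , inj₁ i) + ∑[ i < h ] F (p , inj₂ i))

-- The left summand is the large part; the right one records a small part, a half of it and a
-- position. Adjacency is pulled back along this map, and `sum-decode` transports degree sums.
decode : ∀ c q h → Fin (c + q * (h + h)) → Fin c ⊎ Halves q h
decode c q h v = Sum.map₂ (λ w → Product.map₂ (splitAt h) (remQuot {q} (h + h) w)) (splitAt c v)

decode-↑ˡ : ∀ c q h i → decode c q h (i ↑ˡ (q * (h + h))) ≡ inj₁ i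
decode-↑ˡ c q h i = cong (Sum.map₂ _) (splitAt-↑ˡ c i (q * (h + h)))

decode-↑ʳ : ∀ c q h (p : Fin q) x → decode c q h (c ↑ʳ combine p x) ≡ inj₂ (p , splitAt h x)
decode-↑ʳ c q h p x = trans
  (cong (Sum.map₂ _) (splitAt-↑ʳ c (q * (h + h)) (combine p x)))
  (cong (inj₂ ∘ Product.map₂ (splitAt h)) (remQuot-combine p x))

sum-decode : ∀ c q h (F : Fin c ⊎ Halves q h → ℕ) →
  ∑[ v < c + q * (h + h) ] F (decode c q h v) ≡ ∑[ i < c ] F (inj₁ i) + sumHalves q h (F ∘ inj₂)
sum-decode c q h F = trans (sum-↑ c (F ∘ decode c q h)) (cong₂ _+_
  (sum-cong-≗ (λ i → cong F (decode-↑ˡ c q h i)))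
  (trans (sum-combine q _) (sum-cong-≗ λ p → trans (sum-↑ h _) (cong₂ _+_
    (sum-cong-≗ (λ i → cong F (trans (decode-↑ʳ c q h p (i ↑ˡ h)) (cong (λ y → inj₂ (p , y)) (splitAt-↑ˡ h i h)))))
    (sum-cong-≗ (λ i → cong F (trans (decode-↑ʳ c q h p (h ↑ʳ i)) (cong (λ y → inj₂ (p , y)) (splitAt-↑ʳ h h i)))))))))

sumHalves-cong : ∀ {q h} {F F′ : Halves q h → ℕ} → (∀ w → F w ≡ F′ w) → sumHalves q h F ≡ sumHalves q h F′
sumHalves-cong eq = sum-cong-≗ (λ p →
  cong₂ _+_ (sum-cong-≗ (λ i → eq (p , inj₁ i))) (sum-cong-≗ (λ i → eq (p , inj₂ i))))

sumHalves-+ : ∀ {q h} (F F′ : Halves q h → ℕ) →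
  sumHalves q h (λ w → F w + F′ w) ≡ sumHalves q h F + sumHalves q h F′
sumHalves-+ {q} {h} F F′ = trans
  (sum-cong-≗ (λ p → trans
    (cong₂ _+_ (∑-distrib-+ (λ i → F (p , inj₁ i)) (λ i → F′ (p , inj₁ i)))
               (∑-distrib-+ (λ i → F (p , inj₂ i)) (λ i → F′ (p , inj₂ i))))
    (interchange (∑[ i < h ] F (p , inj₁ i)) (∑[ i < h ] F′ (p , inj₁ i))
                 (∑[ i < h ] F (p , inj₂ i)) (∑[ i < h ] F′ (p , inj₂ i)))))
  (∑-distrib-+ (λ p → ∑[ i < h ] F (p , inj₁ i) + ∑[ i < h ] F (p , inj₂ i))
               (λ p → ∑[ i < h ] F′ (p , inj₁ i) + ∑[ i < h ] F′ (p , inj₂ i)))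
  where
  interchange : ∀ a b c d → (a + b) + (c + d) ≡ (a + c) + (b + d)
  interchange = solve-∀

sumHalves-fst : ∀ {q h} (g : Fin q → ℕ) → sumHalves q h (g ∘ proj₁) ≡ (h + h) * sum g
sumHalves-fst {q} {h} g = trans
  (sum-cong-≗ (λ p → trans (cong₂ _+_ (sum-const h (g p)) (sum-const h (g p))) (sym (*-distribʳ-+ (g p) h h))))
  (sym (*-distribˡ-sum (h + h) g))

sumHalves-1 : ∀ q h → sumHalves q h (λ _ → 1) ≡ q * (h + h)
sumHalves-1 q h = trans (sumHalves-fst {q} {h} (λ _ → 1))
  (trans (cong ((h + h) *_) (trans (sum-const q 1) (*-identityʳ q))) (*-comm (h + h) q))

-- The regular graph close to the Turán graph

module NearTurán (q₀ h₀ s : ℕ) (s≤h : s ≤ suc h₀) where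
  q h c order : ℕ
  q = suc (suc q₀)
  h = suc h₀
  c = (h + h) + s
  order = c + q * (h + h)

  W V : Set
  W = Halves q h
  V = Fin c ⊎ W

  next : Fin q → Fin q → Bool
  next p p′ = suc (toℕ p) % q ≡ᵇ toℕ p′

  -- Using i + j rather than i − j makes this s-regular relation symmetric.
  cyc : Fin h → Fin h → Bool
  cyc i j = (toℕ i + toℕ j) % h <ᵇ s

  cut : W → W → Bool
  cut (p , inj₁ i) (p′ , inj₁ j) = false
  cut (p , inj₁ i) (p′ , inj₂ j) = next p p′ ∧ cyc i j
  cut (p , inj₂ i) (p′ , inj₁ j) = next p′ p ∧ cyc i j
  cut (p , inj₂ i) (p′ , inj₂ j) = false

  adjV : V → V → Bool
  adjV (inj₁ _) (inj₁ _) = false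
  adjV (inj₁ _) (inj₂ _) = true
  adjV (inj₂ _) (inj₁ _) = true
  adjV (inj₂ w) (inj₂ w′) = not (does (proj₁ w ≟ᶠ proj₁ w′)) ∧ not (cut w w′)

  cyc-sym : ∀ i j → cyc i j ≡ cyc j i
  cyc-sym i j = cong (λ x → x % h <ᵇ s) (+-comm (toℕ i) (toℕ j))

  cut-sym : ∀ w w′ → cut w w′ ≡ cut w′ w
  cut-sym (p , inj₁ i) (p′ , inj₁ j) = refl
  cut-sym (p , inj₁ i) (p′ , inj₂ j) = cong (next p p′ ∧_) (cyc-sym i j)
  cut-sym (p , inj₂ i) (p′ , inj₁ j) = cong (next p′ p ∧_) (cyc-sym i j)
  cut-sym (p , inj₂ i) (p′ , inj₂ j) = refl

  adjV-sym : ∀ x y → adjV x y ≡ adjV y x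
  adjV-sym (inj₁ _) (inj₁ _) = refl
  adjV-sym (inj₁ _) (inj₂ _) = refl
  adjV-sym (inj₂ _) (inj₁ _) = refl
  adjV-sym (inj₂ w) (inj₂ w′) =
    cong₂ (λ a b → not a ∧ not b) (≟-sym (proj₁ w) (proj₁ w′)) (cut-sym w w′)

  adjV-loopless : ∀ x → adjV x x ≡ false
  adjV-loopless (inj₁ _) = refl
  adjV-loopless (inj₂ (p , x)) rewrite dec-true (p ≟ᶠ p) refl = refl

  colour : V → Fin (suc q)
  colour (inj₁ _)       = zero
  colour (inj₂ (p , _)) = suc p

  colour-proper : ∀ x y → adjV x y ≡ true → colour x ≢ colour y
  colour-proper (inj₁ _) (inj₂ _) _ ()
  colour-proper (inj₂ _) (inj₁ _) _ ()
  colour-proper (inj₂ (p , x)) (inj₂ (p′ , y)) eq same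
    rewrite dec-true (p ≟ᶠ p′) (suc-injective same) with () ← eq

  -- As `j` varies, `i + j` meets each residue modulo `h` once, and `s ≤ h` makes exactly `s`
  -- residues smaller than `s`.
  ∑-cyc : ∀ i → ∑[ j < h ] bit (cyc i j) ≡ s
  ∑-cyc i = trans (sum-residues h₀ (λ x → bit (x <ᵇ s)) (toℕ i)) (sum-bit-< s≤h)

  ∑-next : ∀ p → ∑[ p′ < q ] bit (next p p′) ≡ 1
  ∑-next p = sum-bit-≡ᵇʳ (m%n<n (suc (toℕ p)) q)

  ∑-next⁻¹ : ∀ p → ∑[ p′ < q ] bit (next p′ p) ≡ 1
  ∑-next⁻¹ p = trans (sum-residues (suc q₀) (λ x → bit (x ≡ᵇ toℕ p)) 1) (sum-bit-≡ᵇˡ (toℕ<n p))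

  ∑-∧-cyc : ∀ (g : Fin q → Bool) → ∑[ p < q ] bit (g p) ≡ 1 →
    ∀ i → ∑[ p < q ] ∑[ j < h ] bit (g p ∧ cyc i j) ≡ s
  ∑-∧-cyc g one i = begin
    ∑[ p < q ] ∑[ j < h ] bit (g p ∧ cyc i j)
      ≡⟨ sum-cong-≗ (λ p → trans (sum-cong-≗ (λ j → bit-∧ (g p) (cyc i j)))
           (sym (*-distribˡ-sum (bit (g p)) (bit ∘ cyc i)))) ⟩
    ∑[ p < q ] (bit (g p) * ∑[ j < h ] bit (cyc i j))
      ≡⟨ sum-cong-≗ (λ p → cong (bit (g p) *_) (∑-cyc i)) ⟩
    ∑[ p < q ] (bit (g p) * s)
      ≡⟨ *-distribʳ-sum s (bit ∘ g) ⟨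
    sum (bit ∘ g) * s
      ≡⟨ trans (cong (_* s) one) (*-identityˡ s) ⟩
    s ∎
    where open ≡-Reasoning

  -- A first-half vertex loses `s` edges to the cyclically next part, a second-half vertex `s` edges
  -- to the previous one.
  sumHalves-cut : ∀ w → sumHalves q h (bit ∘ cut w) ≡ s
  sumHalves-cut (p , inj₁ i) = trans
    (sum-cong-≗ {q} (λ p′ → cong (_+ ∑[ j < h ] bit (next p p′ ∧ cyc i j)) (sum-replicate-zero h)))
    (∑-∧-cyc (next p) (∑-next p) i)
  sumHalves-cut (p , inj₂ i) = trans
    (sum-cong-≗ {q} (λ p′ → trans (cong (∑[ j < h ] bit (next p′ p ∧ cyc i j) +_) (sum-replicate-zero h))
      (+-identityʳ _)))
    (∑-∧-cyc (λ p′ → next p′ p) (∑-next⁻¹ p) i)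

  -- Here `q ≥ 2` enters: a single part would be its own successor.
  next-irrefl : ∀ p → next p p ≡ false
  next-irrefl p with m≤n⇒m<n∨m≡n (toℕ<n p)
  ... | inj₁ p+1<q rewrite m<n⇒m%n≡m p+1<q = suc≢ᵇ (toℕ p)
    where
    suc≢ᵇ : ∀ x → (suc x ≡ᵇ x) ≡ false
    suc≢ᵇ zero    = refl
    suc≢ᵇ (suc x) = suc≢ᵇ x
  -- The last index wraps to `0`, but equals `suc q₀` itself.
  ... | inj₂ p+1≡q = trans (cong (λ x → x % q ≡ᵇ toℕ p) p+1≡q)
    (trans (cong (_≡ᵇ toℕ p) (n%n≡0 q)) (cong (0 ≡ᵇ_) (Nat.suc-injective p+1≡q)))

  cut-irrefl : ∀ p x y → cut (p , x) (p , y) ≡ false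
  cut-irrefl p (inj₁ i) (inj₁ j) = refl
  cut-irrefl p (inj₁ i) (inj₂ j) rewrite next-irrefl p = refl
  cut-irrefl p (inj₂ i) (inj₁ j) rewrite next-irrefl p = refl
  cut-irrefl p (inj₂ i) (inj₂ j) = refl

  -- Adjacent, cut and same part are exhaustive and mutually exclusive. Exclusivity holds because
  -- edges are cut only between different parts.
  adjV-partition : ∀ w w′ →
    bit (adjV (inj₂ w) (inj₂ w′)) + (bit (cut w w′) + bit (does (proj₁ w ≟ᶠ proj₁ w′))) ≡ 1
  adjV-partition (p , x) (p′ , y) with p ≟ᶠ p′
  ... | yes refl rewrite cut-irrefl p x y = refl
  ... | no _ with cut (p , x) (p′ , y)
  ...   | true  = refl
  ...   | false = refl

  -- A small-part vertex gains `c = 2h + s` neighbours in the large part, exactly what it lacks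
  -- among the small ones: `2h` in its own part and `s` cut. Adding the missing vertices back avoids
  -- subtraction.
  degV : ∀ x → ∑[ v < order ] bit (adjV x (decode c q h v)) ≡ q * (h + h)
  degV (inj₁ i) = trans (sum-decode c q h (bit ∘ adjV (inj₁ i)))
    (cong₂ _+_ (sum-replicate-zero c) (sumHalves-1 q h))
  degV (inj₂ w) = begin
    ∑[ v < order ] bit (adjV (inj₂ w) (decode c q h v))
      ≡⟨ sum-decode c q h (bit ∘ adjV (inj₂ w)) ⟩
    ∑[ i < c ] 1 + sumHalves q h A
      ≡⟨ cong (_+ sumHalves q h A) (trans (sum-const c 1) (*-identityʳ c)) ⟩
    (h + h) + s + sumHalves q h A
      ≡⟨ trans (+-comm ((h + h) + s) (sumHalves q h A)) (cong (sumHalves q h A +_) (+-comm (h + h) s)) ⟩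
    sumHalves q h A + (s + (h + h))
      ≡⟨ cong (sumHalves q h A +_) (cong₂ _+_ (sumHalves-cut w)
           (trans (sumHalves-fst {q} {h} E) (trans (cong ((h + h) *_) (sum-bit-≟ (proj₁ w))) (*-identityʳ (h + h))))) ⟨
    sumHalves q h A + (sumHalves q h (bit ∘ cut w) + sumHalves q h (E ∘ proj₁))
      ≡⟨ trans (sumHalves-+ A (λ w′ → bit (cut w w′) + E (proj₁ w′))) (cong (sumHalves q h A +_) (sumHalves-+ (bit ∘ cut w) (E ∘ proj₁))) ⟨
    sumHalves q h (λ w′ → A w′ + (bit (cut w w′) + E (proj₁ w′)))
      ≡⟨ sumHalves-cong (adjV-partition w) ⟩
    sumHalves q h (λ _ → 1)
      ≡⟨ sumHalves-1 q h ⟩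
    q * (h + h) ∎
    where
    open ≡-Reasoning
    A : W → ℕ
    A w′ = bit (adjV (inj₂ w) (inj₂ w′))
    E : Fin q → ℕ
    E p′ = bit (does (proj₁ w ≟ᶠ p′))

  graph : Graph order
  graph = record
    { adj      = λ u v → adjV (decode c q h u) (decode c q h v)
    ; sym      = λ u v → adjV-sym (decode c q h u) (decode c q h v)
    ; loopless = λ u → adjV-loopless (decode c q h u)
    }

  regular : Regular graph (q * (h + h))
  regular u = trans (degree-sum graph u) (degV (decode c q h u))

  colorable : Colorable graph (suc q)
  colorable = colour ∘ decode c q h , λ u v → colour-proper (decode c q h u) (decode c q h v)

-- Divide `n` by `D = 2r`: the quotient is the half size `h`, the remainder is the surplus `s` of
-- the large part. The summand `D * D` of the threshold gives `s ≤ h`, and `D * k` makes the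
-- rounding loss at most `n * r`.
near-turán : ∀ q₀ k → ∃ λ N → ∀ n → N ≤ n → ∃ λ d →
  (Σ (Graph n) λ G → Regular G d × Colorable G (3 + q₀)) ×
  (2 + q₀) * n * k ≤ d * (3 + q₀) * k + n * (3 + q₀)
near-turán q₀ k = D * D + D * k , build
  where
  r = 3 + q₀
  D = 2 * r

  n-order : ∀ s h q → s + h * (2 * (1 + q)) ≡ h + h + s + q * (h + h)
  n-order = solve-∀

  n-excess : ∀ s h q k → q * (s + h * (2 * (1 + q))) * k ≡ q * (h + h) * (1 + q) * k + q * (s * k)
  n-excess = solve-∀

  build : ∀ n → D * D + D * k ≤ n → ∃ λ d →
    (Σ (Graph n) λ G → Regular G d × Colorable G r) ×
    (2 + q₀) * n * k ≤ d * r * k + n * r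
  build n N≤n with n / D | n % D | m≡m%n+[m/n]*n n D | m%n<n n D
  ... | x | s | n≡ | s<D = go x D≤x n≡
    where
    open ≤-Reasoning
    D≤x : D ≤ x
    D≤x = ≮⇒≥ λ x<D → <⇒≱ (begin-strict
      n          ≡⟨ n≡ ⟩
      s + x * D  <⟨ +-monoˡ-< (x * D) s<D ⟩
      suc x * D  ≤⟨ *-monoˡ-≤ D x<D ⟩
      D * D      ∎) (m+n≤o⇒m≤o (D * D) N≤n)

    go : ∀ h → D ≤ h → n ≡ s + h * D → ∃ λ d →
      (Σ (Graph n) λ G → Regular G d × Colorable G r) ×
      (2 + q₀) * n * k ≤ d * r * k + n * r
    -- `D ≤ h` with `D` positive excludes `h = 0`.
    go (suc h₀) D≤h n≡ = q * (h + h) ,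
      subst (λ n → Σ (Graph n) λ G → Regular G (q * (h + h)) × Colorable G r)
        (sym (trans n≡ (n-order s h q))) (graph , regular , colorable) , bound
      where
      open NearTurán q₀ h₀ s (≤-trans (<⇒≤ s<D) D≤h)
      bound : q * n * k ≤ q * (h + h) * r * k + n * r
      bound = begin
        q * n * k                              ≡⟨ cong (λ x → q * x * k) n≡ ⟩
        q * (s + h * D) * k                    ≡⟨ n-excess s h q k ⟩
        q * (h + h) * r * k + q * (s * k)      ≤⟨ +-monoʳ-≤ (q * (h + h) * r * k) (*-mono-≤ (n≤1+n q) (*-monoˡ-≤ k (<⇒≤ s<D))) ⟩
        q * (h + h) * r * k + r * (D * k)      ≤⟨ +-monoʳ-≤ (q * (h + h) * r * k) (*-monoʳ-≤ r (m+n≤o⇒n≤o (D * D) N≤n)) ⟩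
        q * (h + h) * r * k + r * n            ≡⟨ cong (q * (h + h) * r * k +_) (*-comm r n) ⟩
        q * (h + h) * r * k + n * r            ∎

-- Upper and lower bounds combined

contains⇒colorable : ∀ {n m r} {G : Graph n} {H : Graph m} → Contains G H → Colorable G r → Colorable H r
contains⇒colorable (f , _ , hom) (col , proper) = col ∘ f , λ u v uv → proper (f u) (f v) (hom u v uv)

dist-≤ : ∀ {a b c} → a ≤ b + c → b ≤ a + c → ∣ a - b ∣ ≤ c
dist-≤ {a} {b} {c} a≤ b≤ with ∣m-n∣≡[m∸n]∨[n∸m] a b
... | inj₁ eq = ≤-trans (≤-reflexive eq) (m≤n+o⇒m∸n≤o a b a≤)
... | inj₂ eq = ≤-trans (≤-reflexive eq) (m≤n+o⇒m∸n≤o b a b≤)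

-- A larger value would give an `H`-free regular graph dense enough for `erdős-stone`, whose `r + 1`
-- classes of size `m` contain `H`.
upper-bound : ∀ {m} (H : Graph m) r → Colorable H (suc r) → ∀ k →
  ∃ λ N → ∀ n → N ≤ n → ∀ ex → IsRegTuran n H ex →
    ex * r * suc k ≤ (r ∸ 1) * n * suc k + n * r
upper-bound {m} H r col k with N , es ← erdős-stone k r m =
  N , λ n N≤n ex ((G , reg , H-free) , _) → ≮⇒≥ λ dense →
    H-free (multipartite⇒contains G H col (es n N≤n G ex (λ u → ≤-reflexive (sym (reg u))) (<⇒≤ dense)))

-- The near-Turán graph is `r`-colourable while `H` is not, so it is `H`-free and its degree is at
-- most `ex`. For `r ≤ 1` the main term vanishes.
lower-bound : ∀ {m} (H : Graph m) r → r ≢ 2 → (∀ c → Colorable H c → suc r ≤ c) → ∀ k →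
  ∃ λ N → ∀ n → N ≤ n → ∀ ex → IsRegTuran n H ex →
    (r ∸ 1) * n * k ≤ ex * r * k + n * r
lower-bound H 0 _ _ k = 0 , λ _ _ _ _ → z≤n
lower-bound H 1 _ _ k = 0 , λ _ _ _ _ → z≤n
lower-bound H 2 r≢2 _ k = contradiction refl r≢2
lower-bound H r@(suc (suc (suc q₀))) _ χ-min k with N , near ← near-turán q₀ k = N , bound
  where
  bound : ∀ n → N ≤ n → ∀ ex → IsRegTuran n H ex → (r ∸ 1) * n * k ≤ ex * r * k + n * r
  bound n N≤n ex (_ , ex-max) with d , (G , reg , col) , large ← near n N≤n =
    ≤-trans large (+-monoˡ-≤ (n * r) (*-monoˡ-≤ k (*-monoˡ-≤ r d≤ex)))
    where
    d≤ex : d ≤ ex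
    d≤ex = ex-max d (G , reg , λ H⊆G → 1+n≰n (χ-min r (contains⇒colorable {G = G} {H = H} H⊆G col)))

-- The `o(1)` is expressed by errors `1/k`: with `r = χ ∸ 1`, dividing by `n * r * k` gives a
-- distance of at most `1/k` between `ex / n` and `1 - 1/r`.
theorem12 : ∀ {m} (H : Graph m) → HasEdge H →
    ∀ χ → IsChromaticNumber H χ → χ ≢ 3 →
    ∀ k → 1 ≤ k →
    ∃ λ N → ∀ n → N ≤ n → ∀ ex → IsRegTuran n H ex →
    ∣ ex * (χ ∸ 1) * k - (χ ∸ 2) * n * k ∣ ≤ n * (χ ∸ 1)
-- An endpoint of the edge would need a colour in `Fin 0`.
theorem12 H (u , _) zero ((col , _) , _) _ _ _ with () ← col u
theorem12 H _ (suc r) (col , χ-min) χ≢3 (suc k) _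
  with N₁ , upper ← upper-bound H r col k
     | N₂ , lower ← lower-bound H r (χ≢3 ∘ cong suc) χ-min (suc k)
  = N₁ + N₂ , λ n N≤n ex turán → dist-≤
      (upper n (m+n≤o⇒m≤o N₁ N≤n) ex turán)
      (lower n (m+n≤o⇒n≤o N₁ N≤n) ex turán)
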